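{- Let $\mathcal{Z}_q$, $\mathcal{Z}_q^{\circ}$ and $\mathcal{Z}_q^{\circ}[1]$ be the $\mathbb{Q}$-vector spaces of formal $q$-series defined in the context. Then the following equalities hold: \begin{enumerate} \item[(i)] $\mathcal{Z}_q = \Big\langle \begin{bmatrix} s_1,\dots,s_l\\ r_1,\dots,r_l\end{bmatrix} \;\Big|\; l\ge 0,\ s_1,\dots,s_l\ge 1,\ r_1,\dots,r_l\ge 0\Big\rangle_{\mathbb{Q}}$; \item[(ii)] $\mathcal{Z}_q^{\circ} = \big\langle [s_1,\dots,s_l] \;\big|\; l\ge 0,\ s_1,\dots,s_l\ge 1\big\rangle_{\mathbb{Q}}$; \item[(iii)] $\mathcal{Z}_q^{\circ}[1] = \big\langle [s_1,\dots,s_l] \;\big|\; l\ge 0,\ s_1,\dots,s_l\ge 2\big\rangle_{\mathbb{Q}}$. \end{enumerate}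
   Context: All series are formal power series in $\mathbb{Q}[[q]]$. For integers $s_1,\dots,s_l\ge 1$ and polynomials $Q_1\in t\mathbb{Q}[t]$, $Q_2,\dots,Q_l\in\mathbb{Q}[t]$ set $$\zeta_q(s_1,\dots,s_l;Q_1,\dots,Q_l)=\sum_{n_1>\cdots>n_l>0}\frac{Q_1(q^{n_1})\cdots Q_l(q^{n_l})}{(1-q^{n_1})^{s_1}\cdots(1-q^{n_l})^{s_l}},$$ with the convention that this equals $1$ when $l=0$. Define $\mathcal{Z}_q$ as the $\mathbb{Q}$-span of all $\zeta_q(s_1,\dots,s_l;Q_1,\dots,Q_l)$ with $l\ge0$, $s_j\ge1$, $Q_1\in t\mathbb{Q}[t]$, $Q_2,\dots,Q_l\in\mathbb{Q}[t]$ and $\deg Q_j\le s_j$ for all $j$. Let $\mathcal{Z}_q^{\circ}\subseteq\mathcal{Z}_q$ be the span of those generators in which all $Q_1,\dots,Q_l\in t\mathbb{Q}[t]$, and let $\mathcal{Z}_q^{\circ}[1]$ be the span of those generators with all $Q_j\in t\mathbb{Q}[t]$ and $\deg Q_j\le s_j-1$ for all $j$. For $s_1,\dots,s_l\ge1$, $r_1,\dots,r_l\ge0$ the bi-bracket is $$\begin{bmatrix} s_1,\dots,s_l\\ r_1,\dots,r_l\end{bmatrix}=\sum_{\substack{u_1>\cdots>u_l>0\\ v_1,\dots,v_l>0}}\frac{u_1^{r_1}\cdots u_l^{r_l}}{r_1!\cdots r_l!}\cdot\frac{v_1^{s_1-1}\cdots v_l^{s_l-1}}{(s_1-1)!\cdots(s_l-1)!}\,q^{u_1v_1+\cdots+u_lv_l}\in\mathbb{Q}[[q]],$$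 (equal to $1$ for $l=0$), and the bracket is $[s_1,\dots,s_l]=\begin{bmatrix} s_1,\dots,s_l\\ 0,\dots,0\end{bmatrix}$. -}

module Defs where

open import Data.Nat as ℕ using (ℕ; zero; suc; _≤_; _<?_; _∸_; _!)
open import Data.Nat.Properties using (_!≢0)
open import Data.Nat.Divisibility using (_∣?_)
open import Data.Integer using (+_)
open import Data.Rational using (ℚ; 0ℚ; 1ℚ; _+_; _*_; _/_)
open import Data.List using (List; []; _∷_; length; map)
open import Data.List.Relation.Unary.All using (All)
open import Data.Product using (_×_; _,_; Σ; ∃)
open import Data.Unit using (⊤)
open import Relation.Binary.PropositionalEquality using (_≡_)
open import Relation.Nullary using (yes; no)

Series : Set
Series = ℕ → ℚ

0s : Series
0s _ = 0ℚ

1s : Series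
1s zero    = 1ℚ
1s (suc _) = 0ℚ

_⊕_ : Series → Series → Series
(f ⊕ g) N = f N + g N

_·_ : ℚ → Series → Series
(c · f) N = c * f N

sumBelow : ℕ → (ℕ → ℚ) → ℚ
sumBelow zero    h = 0ℚ
sumBelow (suc n) h = sumBelow n h + h n

_⊛_ : Series → Series → Series
(f ⊛ g) N = sumBelow (suc N) (λ i → f i * g (N ∸ i))

pow : ℕ → Series → Series
pow zero    f = 1s
pow (suc k) f = f ⊛ pow k f

shift : ℕ → Series → Series
shift n f N with N <? n
... | yes _ = 0ℚ
... | no  _ = f (N ∸ n)

mono : ℚ → ℕ → Series
mono c k N with k ℕ.≟ N
... | yes _ = c
... | no  _ = 0ℚ

sumBetween : ℕ → (ℕ → Series) → Series
sumBetween m F N = sumBelow (m ∸ 1) (λ i → F (suc i) N)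

-- Infinite sum Σ_{n ≥ 1} F n of a family with ord (F n) ≥ n (formally
-- convergent): the coefficient of q^N only receives contributions from n ≤ N.
sumPos : (ℕ → Series) → Series
sumPos F N = sumBelow N (λ i → F (suc i) N)

-- Polynomials in ℚ[t] as coefficient lists (constant term first)

Poly : Set
Poly = List ℚ

NoConst : Poly → Set
NoConst []      = ⊤
NoConst (c ∷ _) = c ≡ 0ℚ

DegLe : Poly → ℕ → Set
DegLe Q d = length Q ≤ suc d

evalAt : Poly → ℕ → Series
evalAt []       n = 0s
evalAt (c ∷ cs) n = (c · 1s) ⊕ shift n (evalAt cs n)

-- 1/(1 - q^n) = Σ_{k≥0} q^{nk}  (n ≥ 1)
geom : ℕ → Series
geom n N with n ∣? N
... | yes _ = 1ℚ
... | no  _ = 0ℚ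

zterm : ℕ → Poly → ℕ → Series
zterm s Q n = evalAt Q n ⊛ pow s (geom n)

zetaBelow : List (ℕ × Poly) → ℕ → Series
zetaBelow []            m = 1s
zetaBelow ((s , Q) ∷ r) m = sumBetween m (λ n → zterm s Q n ⊛ zetaBelow r n)

zetaq : List (ℕ × Poly) → Series
zetaq []            = 1s
zetaq ((s , Q) ∷ r) = sumPos (λ n → zterm s Q n ⊛ zetaBelow r n)

GoodEntry : ℕ × Poly → Set
GoodEntry (s , Q) = (1 ≤ s) × DegLe Q s

CircEntry : ℕ × Poly → Set
CircEntry (s , Q) = (1 ≤ s) × NoConst Q × DegLe Q s

Circ1Entry : ℕ × Poly → Set
Circ1Entry (s , Q) = (1 ≤ s) × NoConst Q × (length Q ≤ s)   -- deg Q ≤ s - 1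

FirstNoConst : List (ℕ × Poly) → Set
FirstNoConst []            = ⊤
FirstNoConst ((s , Q) ∷ _) = NoConst Q

ZIdx : Set
ZIdx = Σ (List (ℕ × Poly)) (λ L → FirstNoConst L × All GoodEntry L)

ZCircIdx : Set
ZCircIdx = Σ (List (ℕ × Poly)) (All CircEntry)

ZCirc1Idx : Set
ZCirc1Idx = Σ (List (ℕ × Poly)) (All Circ1Entry)

zetaGen : ZIdx → Series
zetaGen (L , _) = zetaq L

zetaCircGen : ZCircIdx → Series
zetaCircGen (L , _) = zetaq L

zetaCirc1Gen : ZCirc1Idx → Series
zetaCirc1Gen (L , _) = zetaq L

natQ : ℕ → ℚ
natQ n = (+ n) / 1

powFact : ℕ → ℕ → ℚ
powFact n a = _/_ (+ (n ℕ.^ a)) (a !) {{a !≢0}}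

bterm : ℕ → ℕ → ℕ → Series
bterm s r u = sumPos (λ v → mono (powFact u r * powFact v (s ∸ 1)) (u ℕ.* v))

bracketBelow : List (ℕ × ℕ) → ℕ → Series
bracketBelow []            m = 1s
bracketBelow ((s , r) ∷ L) m = sumBetween m (λ u → bterm s r u ⊛ bracketBelow L u)

bibracket : List (ℕ × ℕ) → Series
bibracket []            = 1s
bibracket ((s , r) ∷ L) = sumPos (λ u → bterm s r u ⊛ bracketBelow L u)

bracket : List ℕ → Series
bracket ss = bibracket (map (λ s → (s , 0)) ss)

BiIdx : Set
BiIdx = Σ (List (ℕ × ℕ)) (All (λ p → 1 ≤ Data.Product.proj₁ p))

BrIdx : ℕ → Set
BrIdx k = Σ (List ℕ) (All (λ s → k ≤ s))

biGen : BiIdx → Series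
biGen (L , _) = bibracket L

brGen : (k : ℕ) → BrIdx k → Series
brGen k (L , _) = bracket L

lincomb : {I : Set} → (I → Series) → List (ℚ × I) → Series
lincomb g []             = 0s
lincomb g ((c , i) ∷ cs) = (c · g i) ⊕ lincomb g cs

InSpan : {I : Set} → (I → Series) → Series → Set
InSpan g f = ∃ λ cs → ∀ N → f N ≡ lincomb g cs N

SameSpan : {I J : Set} → (I → Series) → (J → Series) → Set
SameSpan g h = ∀ f → (InSpan g f → InSpan h f) × (InSpan h f → InSpan g f)

{-# OPTIONS --safe #-}

-- Put t = q^n and x = t/(1-t), so that 1/(1-t) = 1+x. A letter Q(t)/(1-t)^s with deg Q ≤ s is a
-- polynomial in x, with no constant term if Q(0) = 0, and moreover divisible by 1+x if
-- deg Q ≤ s-1. The coefficient of t^v in x^(k+1) is the binomial (v-1 choose k), so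
-- x ℚ[x] = ⟨Σ v^p t^v : p ≥ 0⟩ and x(1+x) ℚ[x] = ⟨Σ v^p t^v : p ≥ 1⟩. Both (ii) and (iii) are this
-- change of basis, applied letter by letter.
--
-- In (i) the additional letter 1 is the operator F ↦ Σ_{n<m} F(n). Summation by parts shows that
-- the span of the truncated ζ-sums is closed under multiplication by m, hence contains the
-- truncated bi-brackets; and that the span of the products m^r · (truncated bi-bracket) is closed
-- under this operator, hence contains the truncated ζ-sums.
module Submission where

open import Defs
open import Data.Nat as ℕ using (ℕ; zero; suc; _∸_; _!)
open import Data.Nat.Divisibility using (_∣_; _∣?_; _∣0; >⇒∤; ∣-refl; ∣m∣n⇒∣m+n; ∣m+n∣m⇒∣n)
open import Data.Nat.Induction using (<-rec)
import Data.Nat.Properties as ℕ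
import Data.Integer as ℤ
import Data.Integer.Properties as ℤ
open import Data.Integer using () renaming (+_ to int)
open import Data.List using (List; []; _∷_; _++_; length; map)
open import Data.List.Relation.Unary.All using (All; []; _∷_)
open import Data.Maybe using (Maybe; nothing; just)
open import Data.Product using (_×_; _,_; ∃; proj₁)
open import Data.Rational using (ℚ; 0ℚ; 1ℚ; _+_; _*_; -_; _/_; fromℚᵘ)
open import Data.Rational.Properties
open import Data.Rational.Solver using (module +-*-Solver)
open import Data.Rational.Unnormalised as ℚᵘ using (mkℚᵘ; *≡*)
import Data.Rational.Unnormalised.Properties as ℚᵘ
open import Function using (_∘_)
open import Relation.Binary.PropositionalEquality
  using (_≡_; _≢_; _≗_; refl; subst; sym; trans; cong; cong₂; module ≡-Reasoning)
open import Relation.Nullary using (¬_; yes; no; contradiction)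
open +-*-Solver using (solve; con; _:=_; _:+_; _:*_)
open ≡-Reasoning

private variable
  A B I K : Set

-- Rational arithmetic, factorials, powers and binomial coefficients.

fromℚᵘ-homo-+ : ∀ p q → fromℚᵘ (p ℚᵘ.+ q) ≡ fromℚᵘ p + fromℚᵘ q
fromℚᵘ-homo-+ p q = toℚᵘ-injective (ℚᵘ.≃-trans (toℚᵘ-fromℚᵘ (p ℚᵘ.+ q))
  (ℚᵘ.≃-sym (ℚᵘ.≃-trans (toℚᵘ-homo-+ (fromℚᵘ p) (fromℚᵘ q))
    (ℚᵘ.+-cong (toℚᵘ-fromℚᵘ p) (toℚᵘ-fromℚᵘ q)))))

fromℚᵘ-homo-* : ∀ p q → fromℚᵘ (p ℚᵘ.* q) ≡ fromℚᵘ p * fromℚᵘ q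
fromℚᵘ-homo-* p q = toℚᵘ-injective (ℚᵘ.≃-trans (toℚᵘ-fromℚᵘ (p ℚᵘ.* q))
  (ℚᵘ.≃-sym (ℚᵘ.≃-trans (toℚᵘ-homo-* (fromℚᵘ p) (fromℚᵘ q))
    (ℚᵘ.*-cong (toℚᵘ-fromℚᵘ p) (toℚᵘ-fromℚᵘ q)))))

natQ-suc : ∀ n → natQ (suc n) ≡ 1ℚ + natQ n
natQ-suc n = trans
  (fromℚᵘ-cong {mkℚᵘ (int (suc n)) 0} {mkℚᵘ (int 1) 0 ℚᵘ.+ mkℚᵘ (int n) 0}
    (*≡* (cong (λ z → (int 1 ℤ.+ z) ℤ.* int 1) (sym (ℤ.*-identityʳ (int n))))))
  (fromℚᵘ-homo-+ (mkℚᵘ (int 1) 0) (mkℚᵘ (int n) 0))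

natQ-* : ∀ m n → natQ (m ℕ.* n) ≡ natQ m * natQ n
natQ-* m n = trans (cong (_/ 1) (ℤ.pos-* m n)) (fromℚᵘ-homo-* (mkℚᵘ (int m) 0) (mkℚᵘ (int n) 0))

/-as-* : ∀ m d .{{_ : ℕ.NonZero d}} → int m / d ≡ (int 1 / d) * natQ m
/-as-* m (suc d) = trans
  (fromℚᵘ-cong {mkℚᵘ (int m) d} {mkℚᵘ (int 1) d ℚᵘ.* mkℚᵘ (int m) 0}
    (*≡* (cong₂ ℤ._*_ (sym (ℤ.*-identityˡ (int m))) (cong (int ∘ suc) (ℕ.*-identityʳ d)))))
  (fromℚᵘ-homo-* (mkℚᵘ (int 1) d) (mkℚᵘ (int m) 0))

1/d*d≡1 : ∀ d .{{_ : ℕ.NonZero d}} → (int 1 / d) * natQ d ≡ 1ℚ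
1/d*d≡1 d@(suc d') = trans (sym (/-as-* d d))
  (fromℚᵘ-cong {mkℚᵘ (int d) d'} {mkℚᵘ (int 1) 0} (*≡* (ℤ.*-comm (int d) (int 1))))

invFact : ℕ → ℚ
invFact a = _/_ (int 1) (a !) {{a ℕ.!≢0}}

invFact*fact : ∀ a → invFact a * natQ (a !) ≡ 1ℚ
invFact*fact a = 1/d*d≡1 (a !) {{a ℕ.!≢0}}

-- Positive summation indices are stored shifted by one: `i` stands for i+1, so this is (i+1)^r.
power : ℕ → ℕ → ℚ
power zero    i = 1ℚ
power (suc r) i = natQ (suc i) * power r i

natQ-^ : ∀ i r → natQ (suc i ℕ.^ r) ≡ power r i
natQ-^ i zero    = refl
natQ-^ i (suc r) = trans (natQ-* (suc i) (suc i ℕ.^ r)) (cong (natQ (suc i) *_) (natQ-^ i r))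

powFact-power : ∀ i r → powFact (suc i) r ≡ invFact r * power r i
powFact-power i r = trans (/-as-* (suc i ℕ.^ r) (r !) {{r ℕ.!≢0}}) (cong (invFact r *_) (natQ-^ i r))

-- bin k i is (i choose k), with the lower entry first.
bin : ℕ → ℕ → ℚ
bin zero    i       = 1ℚ
bin (suc k) zero    = 0ℚ
bin (suc k) (suc i) = bin k i + bin (suc k) i

-- The absorption identity for (i+1 choose k+1), which Pascal's rule expands on the right. It trades
-- multiplication by i+1 for a step in the lower index and drives both changes of basis.
bin-recurrence : ∀ k i → natQ (suc i) * bin k i ≡ natQ (suc k) * (bin k i + bin (suc k) i)
bin-recurrence zero    zero    = refl
bin-recurrence (suc k) zero    = trans (*-zeroʳ 1ℚ) (sym (*-zeroʳ (natQ (suc (suc k)))))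
bin-recurrence zero    (suc i) = begin
  natQ (suc (suc i)) * 1ℚ          ≡⟨ cong (_* 1ℚ) (natQ-suc (suc i)) ⟩
  (1ℚ + natQ (suc i)) * 1ℚ         ≡⟨ solve 1 (λ a → (con 1ℚ :+ a) :* con 1ℚ := con 1ℚ :+ a :* con 1ℚ) refl (natQ (suc i)) ⟩
  1ℚ + natQ (suc i) * 1ℚ           ≡⟨ cong (1ℚ +_) (bin-recurrence zero i) ⟩
  1ℚ + 1ℚ * (1ℚ + bin 1 i)         ≡⟨ solve 1 (λ a → con 1ℚ :+ con 1ℚ :* a := con 1ℚ :* (con 1ℚ :+ a)) refl (1ℚ + bin 1 i) ⟩
  1ℚ * (1ℚ + (1ℚ + bin 1 i))       ∎
bin-recurrence (suc k) (suc i) = begin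
  natQ (suc (suc i)) * (x + y)
    ≡⟨ cong (_* (x + y)) (natQ-suc (suc i)) ⟩
  (1ℚ + natQ (suc i)) * (x + y)
    ≡⟨ solve 3 (λ a b c → (con 1ℚ :+ a) :* (b :+ c) := (b :+ c) :+ (a :* b :+ a :* c)) refl (natQ (suc i)) x y ⟩
  (x + y) + (natQ (suc i) * x + natQ (suc i) * y)
    ≡⟨ cong ((x + y) +_) (cong₂ _+_ (bin-recurrence k i) (bin-recurrence (suc k) i)) ⟩
  (x + y) + (natQ (suc k) * (x + y) + natQ (suc (suc k)) * (y + z))
    ≡⟨ cong (λ w → (x + y) + (natQ (suc k) * (x + y) + w * (y + z))) (natQ-suc (suc k)) ⟩
  (x + y) + (natQ (suc k) * (x + y) + (1ℚ + natQ (suc k)) * (y + z))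
    ≡⟨ solve 4 (λ b c d e → (b :+ c) :+ (e :* (b :+ c) :+ (con 1ℚ :+ e) :* (c :+ d))
          := (con 1ℚ :+ e) :* ((b :+ c) :+ (c :+ d))) refl x y z (natQ (suc k)) ⟩
  (1ℚ + natQ (suc k)) * ((x + y) + (y + z))
    ≡⟨ cong (_* ((x + y) + (y + z))) (natQ-suc (suc k)) ⟨
  natQ (suc (suc k)) * ((x + y) + (y + z)) ∎
  where
    x = bin k i
    y = bin (suc k) i
    z = bin (suc (suc k)) i

-- Spans and linear maps

-- An inductive form of `InSpan`, over any domain `A`, so that coefficient functions, families and
-- series are treated alike. The constructor `resp` stands in for function extensionality.
data Span (g : I → A → ℚ) : (A → ℚ) → Set where
  gen  : ∀ i → Span g (g i)
  null : Span g (λ _ → 0ℚ)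
  add  : ∀ {f h} → Span g f → Span g h → Span g (λ x → f x + h x)
  mul  : ∀ c {f} → Span g f → Span g (λ x → c * f x)
  resp : ∀ {f h} → f ≗ h → Span g f → Span g h

record Linear (φ : (A → ℚ) → (B → ℚ)) : Set where
  field
    ≗-cong : ∀ {f h} → f ≗ h → φ f ≗ φ h
    homo-+ : ∀ f h → φ (λ x → f x + h x) ≗ (λ y → φ f y + φ h y)
    homo-* : ∀ c f → φ (λ x → c * f x) ≗ (λ y → c * φ f y)

  homo-0 : φ (λ _ → 0ℚ) ≗ (λ _ → 0ℚ)
  homo-0 y = trans (homo-* 0ℚ (λ _ → 0ℚ) y) (*-zeroˡ (φ (λ _ → 0ℚ) y))

open Linear

id-linear : Linear {A} (λ f → f)
id-linear .≗-cong f≗h    = f≗h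
id-linear .homo-+ _ _ _ = refl
id-linear .homo-* _ _ _ = refl

_∘-linear_ : ∀ {C : Set} {φ : (B → ℚ) → (C → ℚ)} {ψ : (A → ℚ) → (B → ℚ)} →
             Linear φ → Linear ψ → Linear (φ ∘ ψ)
(L ∘-linear M) .≗-cong e       = L .≗-cong (M .≗-cong e)
(L ∘-linear M) .homo-+ f h x   = trans (L .≗-cong (M .homo-+ f h) x) (L .homo-+ _ _ x)
(L ∘-linear M) .homo-* c f x   = trans (L .≗-cong (M .homo-* c f) x) (L .homo-* c _ x)

-- Reduces an inclusion of spans to the generators. A bilinear map is handled by applying it once in
-- each argument.
map-Span : ∀ {g : I → A → ℚ} {h : K → B → ℚ} {φ f} → Linear φ →
           (∀ i → Span h (φ (g i))) → Span g f → Span h (φ f)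
map-Span L σ (gen i)      = σ i
map-Span L σ null         = resp (sym ∘ homo-0 L) null
map-Span L σ (add s t)    = resp (sym ∘ homo-+ L _ _) (add (map-Span L σ s) (map-Span L σ t))
map-Span L σ (mul c s)    = resp (sym ∘ homo-* L c _) (mul c (map-Span L σ s))
map-Span L σ (resp f≗h s) = resp (≗-cong L f≗h) (map-Span L σ s)

Span-trans : ∀ {g : I → A → ℚ} {h : K → A → ℚ} {f} → (∀ i → Span h (g i)) → Span g f → Span h f
Span-trans = map-Span id-linear

cancel : ∀ {g : I → A → ℚ} {f} c d → d * c ≡ 1ℚ → Span g (λ x → c * f x) → Span g f
cancel {f = f} c d dc≡1 s = resp (λ x → begin
  d * (c * f x)  ≡⟨ *-assoc d c (f x) ⟨
  d * c * f x    ≡⟨ cong (_* f x) dc≡1 ⟩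
  1ℚ * f x       ≡⟨ *-identityˡ (f x) ⟩
  f x            ∎) (mul d s)

subtract : ∀ {g : I → A → ℚ} {f h} → Span g (λ x → f x + h x) → Span g f → Span g h
subtract {f = f} {h} s t = resp
  (λ x → solve 2 (λ a b → (a :+ b) :+ con (- 1ℚ) :* a := b) refl (f x) (h x)) (add s (mul (- 1ℚ) t))

lincomb-Span : ∀ (g : I → Series) cs → Span g (lincomb g cs)
lincomb-Span g []             = null
lincomb-Span g ((c , i) ∷ cs) = add (mul c (gen i)) (lincomb-Span g cs)

InSpan⇒Span : ∀ {g : I → Series} {f} → InSpan g f → Span g f
InSpan⇒Span {g = g} (cs , f≗cs) = resp (sym ∘ f≗cs) (lincomb-Span g cs)

lincomb-++ : ∀ (g : I → Series) cs ds → lincomb g (cs ++ ds) ≗ lincomb g cs ⊕ lincomb g ds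
lincomb-++ g []             ds N = sym (+-identityˡ _)
lincomb-++ g ((c , i) ∷ cs) ds N = trans
  (cong (λ z → c * g i N + z) (lincomb-++ g cs ds N))
  (sym (+-assoc (c * g i N) (lincomb g cs N) (lincomb g ds N)))

lincomb-* : ∀ (g : I → Series) c cs → lincomb g (map (λ (d , i) → c * d , i) cs) ≗ c · lincomb g cs
lincomb-* g c []             N = sym (*-zeroʳ c)
lincomb-* g c ((d , i) ∷ cs) N = trans (cong₂ _+_ (*-assoc c d (g i N)) (lincomb-* g c cs N))
  (sym (*-distribˡ-+ c (d * g i N) (lincomb g cs N)))

Span⇒InSpan : ∀ {g : I → Series} {f} → Span g f → InSpan g f
Span⇒InSpan {g = g} (gen i) = (1ℚ , i) ∷ [] , λ N → sym (trans (+-identityʳ _) (*-identityˡ (g i N)))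
Span⇒InSpan null         = [] , λ _ → refl
Span⇒InSpan {g = g} (add s t) with cs , p ← Span⇒InSpan s | ds , q ← Span⇒InSpan t =
  cs ++ ds , λ N → trans (cong₂ _+_ (p N) (q N)) (sym (lincomb-++ g cs ds N))
Span⇒InSpan {g = g} (mul c s) with cs , p ← Span⇒InSpan s =
  map (λ (d , i) → c * d , i) cs , λ N → trans (cong (c *_) (p N)) (sym (lincomb-* g c cs N))
Span⇒InSpan (resp f≗h s) with cs , p ← Span⇒InSpan s = cs , λ N → trans (sym (f≗h N)) (p N)

sameSpan : ∀ {g : I → Series} {h : K → Series} →
           (∀ i → Span h (g i)) → (∀ j → Span g (h j)) → SameSpan g h
sameSpan g⊆h h⊆g f = (λ s → Span⇒InSpan (Span-trans g⊆h (InSpan⇒Span s)))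
                   , (λ s → Span⇒InSpan (Span-trans h⊆g (InSpan⇒Span s)))

scale-linear : (c : A → ℚ) → Linear {A} (λ f x → c x * f x)
scale-linear c .≗-cong f≗h x    = cong (c x *_) (f≗h x)
scale-linear c .homo-+ f h x    = *-distribˡ-+ (c x) (f x) (h x)
scale-linear c .homo-* d f x    = solve 3 (λ a b e → a :* (b :* e) := b :* (a :* e)) refl (c x) d (f x)

-- Change of basis between powers and binomial coefficients.

bin₁ : ℕ → ℕ → ℚ
bin₁ k i = bin k i + bin (suc k) i

-- By Pascal's rule `bin₁ k i` is (i+1 choose k+1). Joint induction: `bin₁ k` is 1/(k+1) times
-- (i+1)·`bin k`, where the factor i+1 raises every exponent by one, and `bin (suc k)` is `bin₁ k`
-- minus `bin k`.
bin∈power : ∀ k → Span power (bin k)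
bin₁∈power∘suc : ∀ k → Span (power ∘ suc) (bin₁ k)

bin₁∈power∘suc k = cancel (natQ (suc k)) (int 1 / suc k) (1/d*d≡1 (suc k)) (resp (bin-recurrence k)
  (map-Span (scale-linear (natQ ∘ suc)) gen (bin∈power k)))

bin∈power zero    = resp (λ _ → refl) (gen 0)
bin∈power (suc k) = subtract (Span-trans (gen ∘ suc) (bin₁∈power∘suc k)) (bin∈power k)

-- The reverse induction: multiplication by i+1 sends `bin k` to k+1 times `bin₁ k`.
power∘suc∈bin₁ : ∀ r → Span bin₁ (power (suc r))
power∈bin : ∀ r → Span bin (power r)

power∘suc∈bin₁ r = map-Span (scale-linear (natQ ∘ suc))
  (λ k → resp (sym ∘ bin-recurrence k) (mul (natQ (suc k)) (gen k))) (power∈bin r)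

power∈bin zero    = resp (λ _ → refl) (gen 0)
power∈bin (suc r) = Span-trans (λ k → add (gen k) (gen (suc k))) (power∘suc∈bin₁ r)

-- Finite sums.

+-interchange : ∀ a b c d → (a + b) + (c + d) ≡ (a + c) + (b + d)
+-interchange = solve 4 (λ a b c d → (a :+ b) :+ (c :+ d) := (a :+ c) :+ (b :+ d)) refl

sumBelow-cong : ∀ n {h h'} → h ≗ h' → sumBelow n h ≡ sumBelow n h'
sumBelow-cong zero    e = refl
sumBelow-cong (suc n) e = cong₂ _+_ (sumBelow-cong n e) (e n)

sumBelow-+ : ∀ n h h' → sumBelow n (λ i → h i + h' i) ≡ sumBelow n h + sumBelow n h'
sumBelow-+ zero    h h' = refl
sumBelow-+ (suc n) h h' = trans (cong (_+ (h n + h' n)) (sumBelow-+ n h h'))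
  (+-interchange (sumBelow n h) (sumBelow n h') (h n) (h' n))

sumBelow-* : ∀ n c h → sumBelow n (λ i → c * h i) ≡ c * sumBelow n h
sumBelow-* zero    c h = sym (*-zeroʳ c)
sumBelow-* (suc n) c h = trans (cong (_+ c * h n) (sumBelow-* n c h))
  (sym (*-distribˡ-+ c (sumBelow n h) (h n)))

sumBelow-zero : ∀ n h → (∀ i → i ℕ.< n → h i ≡ 0ℚ) → sumBelow n h ≡ 0ℚ
sumBelow-zero zero    h e = refl
sumBelow-zero (suc n) h e =
  cong₂ _+_ (sumBelow-zero n h (λ i i<n → e i (ℕ.m<n⇒m<1+n i<n))) (e n ℕ.≤-refl)

sumBelow-split : ∀ n m h → sumBelow (n ℕ.+ m) h ≡ sumBelow n h + sumBelow m (λ i → h (n ℕ.+ i))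
sumBelow-split n zero    h rewrite ℕ.+-identityʳ n = sym (+-identityʳ (sumBelow n h))
sumBelow-split n (suc m) h rewrite ℕ.+-suc n m = trans (cong (_+ h (n ℕ.+ m)) (sumBelow-split n m h))
  (+-assoc (sumBelow n h) (sumBelow m (λ i → h (n ℕ.+ i))) (h (n ℕ.+ m)))

sumBelow-head : ∀ n h → sumBelow (suc n) h ≡ h 0 + sumBelow n (h ∘ suc)
sumBelow-head n h = trans (sumBelow-split 1 n h) (cong (_+ sumBelow n (h ∘ suc)) (+-identityˡ (h 0)))

-- Power series

⊛-cong : ∀ {f f' g g'} → f ≗ f' → g ≗ g' → f ⊛ g ≗ f' ⊛ g'
⊛-cong e e' N = sumBelow-cong (suc N) (λ i → cong₂ _*_ (e i) (e' (N ∸ i)))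

⊛-linearˡ : ∀ g → Linear (_⊛ g)
⊛-linearˡ g .≗-cong e       = ⊛-cong {g = g} e (λ _ → refl)
⊛-linearˡ g .homo-+ f f' N = trans
  (sumBelow-cong (suc N) (λ i → *-distribʳ-+ (g (N ∸ i)) (f i) (f' i)))
  (sumBelow-+ (suc N) (λ i → f i * g (N ∸ i)) (λ i → f' i * g (N ∸ i)))
⊛-linearˡ g .homo-* c f N = trans
  (sumBelow-cong (suc N) (λ i → *-assoc c (f i) (g (N ∸ i))))
  (sumBelow-* (suc N) c (λ i → f i * g (N ∸ i)))

⊛-linearʳ : ∀ f → Linear (f ⊛_)
⊛-linearʳ f .≗-cong e      = ⊛-cong {f} (λ _ → refl) e
⊛-linearʳ f .homo-+ g g' N = trans
  (sumBelow-cong (suc N) (λ i → *-distribˡ-+ (f i) (g (N ∸ i)) (g' (N ∸ i))))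
  (sumBelow-+ (suc N) (λ i → f i * g (N ∸ i)) (λ i → f i * g' (N ∸ i)))
⊛-linearʳ f .homo-* c g N = trans
  (sumBelow-cong (suc N) (λ i →
    solve 3 (λ a b e → a :* (b :* e) := b :* (a :* e)) refl (f i) c (g (N ∸ i))))
  (sumBelow-* (suc N) c (λ i → f i * g (N ∸ i)))

⊛-identityˡ : ∀ f → 1s ⊛ f ≗ f
⊛-identityˡ f N = begin
  sumBelow (suc N) (λ i → 1s i * f (N ∸ i))                    ≡⟨ sumBelow-head N (λ i → 1s i * f (N ∸ i)) ⟩
  1ℚ * f N + sumBelow N (λ i → 0ℚ * f (N ∸ suc i))             ≡⟨ cong₂ _+_ (*-identityˡ (f N))
                                                                     (sumBelow-zero N _ (λ i _ → *-zeroˡ (f (N ∸ suc i)))) ⟩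
  f N + 0ℚ                                                     ≡⟨ +-identityʳ (f N) ⟩
  f N                                                          ∎

shift-unfold : ∀ n f h → (∀ N → N ℕ.< n → h N ≡ 0ℚ) → (∀ M → h (n ℕ.+ M) ≡ f M) → shift n f ≗ h
shift-unfold n f h low high N with N ℕ.<? n
... | yes N<n = sym (low N N<n)
... | no  N≮n = trans (sym (high (N ∸ n))) (cong h (ℕ.m+[n∸m]≡n (ℕ.≮⇒≥ N≮n)))

shift-< : ∀ n f N → N ℕ.< n → shift n f N ≡ 0ℚ
shift-< n f N N<n with N ℕ.<? n
... | yes _   = refl
... | no  N≮n = contradiction N<n N≮n

shift-+ : ∀ n f M → shift n f (n ℕ.+ M) ≡ f M
shift-+ n f M with n ℕ.+ M ℕ.<? n
... | yes n+M<n = contradiction n+M<n (ℕ.m+n≮m n M)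
... | no  _     = cong f (ℕ.m+n∸m≡n n M)

shift-cong-below : ∀ j {f h} N → (∀ {M} → M ℕ.< N → f M ≡ h M) → shift (suc j) f N ≡ shift (suc j) h N
shift-cong-below j N e with N ℕ.<? suc j
shift-cong-below j N       e | yes _   = refl
shift-cong-below j zero    e | no  0≮  = contradiction (ℕ.s≤s ℕ.z≤n) 0≮
shift-cong-below j (suc N) e | no  _   = e (ℕ.s≤s (ℕ.m∸n≤m N j))

shift-linear : ∀ n → Linear (shift n)
shift-linear n .≗-cong e N with N ℕ.<? n
... | yes _ = refl
... | no  _ = e (N ∸ n)
shift-linear n .homo-+ f h N with N ℕ.<? n
... | yes _ = refl
... | no  _ = refl
shift-linear n .homo-* c f N with N ℕ.<? n
... | yes _ = sym (*-zeroʳ c)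
... | no  _ = refl

shift-⊛ : ∀ n f g → shift n f ⊛ g ≗ shift n (f ⊛ g)
shift-⊛ n f g N = sym (shift-unfold n (f ⊛ g) (shift n f ⊛ g) low high N)
  where
  low : ∀ N → N ℕ.< n → (shift n f ⊛ g) N ≡ 0ℚ
  low N N<n = sumBelow-zero (suc N) _ (λ i i<1+N →
    trans (cong (_* g (N ∸ i)) (shift-< n f i (ℕ.<-≤-trans i<1+N N<n))) (*-zeroˡ (g (N ∸ i))))

  high : ∀ M → (shift n f ⊛ g) (n ℕ.+ M) ≡ (f ⊛ g) M
  high M = begin
    sumBelow (suc (n ℕ.+ M)) h                               ≡⟨ cong (λ m → sumBelow m h) (sym (ℕ.+-suc n M)) ⟩
    sumBelow (n ℕ.+ suc M) h                                 ≡⟨ sumBelow-split n (suc M) h ⟩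
    sumBelow n h + sumBelow (suc M) (λ i → h (n ℕ.+ i))      ≡⟨ cong₂ _+_
        (sumBelow-zero n h (λ i i<n → trans (cong (_* g (n ℕ.+ M ∸ i)) (shift-< n f i i<n)) (*-zeroˡ (g (n ℕ.+ M ∸ i)))))
        (sumBelow-cong (suc M) (λ i → cong₂ _*_ (shift-+ n f i) (cong g (ℕ.[m+n]∸[m+o]≡n∸o n M i)))) ⟩
    0ℚ + (f ⊛ g) M                                           ≡⟨ +-identityˡ ((f ⊛ g) M) ⟩
    (f ⊛ g) M                                                ∎
    where
    h : ℕ → ℚ
    h i = shift n f i * g (n ℕ.+ M ∸ i)

-- Strong induction on the degree: a shift by at least one reads only lower coefficients. This
-- replaces division by 1 - q^(j+1).
shift-fixpoint-unique : ∀ j b {f h} → f ≗ b ⊕ shift (suc j) f → h ≗ b ⊕ shift (suc j) h → f ≗ h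
shift-fixpoint-unique j b {f} {h} ef eh = <-rec _ (λ N rec → trans (ef N)
  (trans (cong (b N +_) (shift-cong-below j {f} {h} N rec)) (sym (eh N))))

-- Geometric series and multiplication by polynomials in q^n.

geom-yes : ∀ n N → n ∣ N → geom n N ≡ 1ℚ
geom-yes n N n∣N with n ∣? N
... | yes _   = refl
... | no  n∤N = contradiction n∣N n∤N

geom-no : ∀ n N → ¬ n ∣ N → geom n N ≡ 0ℚ
geom-no n N n∤N with n ∣? N
... | yes n∣N = contradiction n∣N n∤N
... | no  _   = refl

-- Subtracting j+1 does not affect divisibility by j+1. In closed form, 1/(1-t) = 1 + t/(1-t).
geom-fixpoint : ∀ j → geom (suc j) ≗ 1s ⊕ shift (suc j) (geom (suc j))
geom-fixpoint j N with N ℕ.<? suc j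
geom-fixpoint j zero    | yes _  = geom-yes (suc j) 0 (suc j ∣0)
geom-fixpoint j (suc N) | yes lt = geom-no (suc j) (suc N) (>⇒∤ lt)
geom-fixpoint j zero    | no  ≮  = contradiction (ℕ.s≤s ℕ.z≤n) ≮
geom-fixpoint j (suc N) | no  ≮  = trans lemma (sym (+-identityˡ _))
  where
  j≤N : suc j ℕ.≤ suc N
  j≤N = ℕ.≮⇒≥ ≮
  e : suc j ℕ.+ (N ∸ j) ≡ suc N
  e = ℕ.m+[n∸m]≡n j≤N
  lemma : geom (suc j) (suc N) ≡ geom (suc j) (N ∸ j)
  lemma with suc j ∣? (N ∸ j)
  ... | yes d = geom-yes (suc j) (suc N) (subst (suc j ∣_) e (∣m∣n⇒∣m+n ∣-refl d))
  ... | no ¬d = geom-no (suc j) (suc N) (λ d → ¬d (∣m+n∣m⇒∣n (subst (suc j ∣_) (sym e) d) ∣-refl))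

geom-⊛ : ∀ j f → geom (suc j) ⊛ f ≗ f ⊕ shift (suc j) (geom (suc j) ⊛ f)
geom-⊛ j f N = begin
  (geom n ⊛ f) N                          ≡⟨ ⊛-linearˡ f .≗-cong (geom-fixpoint j) N ⟩
  ((1s ⊕ shift n (geom n)) ⊛ f) N         ≡⟨ ⊛-linearˡ f .homo-+ 1s (shift n (geom n)) N ⟩
  (1s ⊛ f) N + (shift n (geom n) ⊛ f) N   ≡⟨ cong₂ _+_ (⊛-identityˡ f N) (shift-⊛ n (geom n) f N) ⟩
  f N + shift n (geom n ⊛ f) N            ∎
  where n = suc j

evalAt-∷-⊛ : ∀ c cs n f → evalAt (c ∷ cs) n ⊛ f ≗ (c · f) ⊕ shift n (evalAt cs n ⊛ f)
evalAt-∷-⊛ c cs n f N = begin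
  (((c · 1s) ⊕ shift n (evalAt cs n)) ⊛ f) N         ≡⟨ ⊛-linearˡ f .homo-+ (c · 1s) (shift n (evalAt cs n)) N ⟩
  ((c · 1s) ⊛ f) N + (shift n (evalAt cs n) ⊛ f) N   ≡⟨ cong₂ _+_
    (trans (⊛-linearˡ f .homo-* c 1s N) (cong (c *_) (⊛-identityˡ f N))) (shift-⊛ n (evalAt cs n) f N) ⟩
  c * f N + shift n (evalAt cs n ⊛ f) N              ∎

-- Induction on `Q` by Horner's scheme. This case suffices in place of general commutativity of `⊛`.
evalAt-⊛-shift : ∀ Q n f → evalAt Q n ⊛ shift n f ≗ shift n (evalAt Q n ⊛ f)
evalAt-⊛-shift []       n f N = trans (homo-0 (⊛-linearˡ (shift n f)) N) (sym (trans
  (shift-linear n .≗-cong (homo-0 (⊛-linearˡ f)) N) (homo-0 (shift-linear n) N)))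
evalAt-⊛-shift (c ∷ cs) n f N = begin
  (evalAt (c ∷ cs) n ⊛ shift n f) N
    ≡⟨ evalAt-∷-⊛ c cs n (shift n f) N ⟩
  c * shift n f N + shift n (evalAt cs n ⊛ shift n f) N
    ≡⟨ cong₂ _+_ (sym (shift-linear n .homo-* c f N)) (shift-linear n .≗-cong (evalAt-⊛-shift cs n f) N) ⟩
  shift n (c · f) N + shift n (shift n (evalAt cs n ⊛ f)) N
    ≡⟨ shift-linear n .homo-+ (c · f) (shift n (evalAt cs n ⊛ f)) N ⟨
  shift n ((c · f) ⊕ shift n (evalAt cs n ⊛ f)) N
    ≡⟨ shift-linear n .≗-cong (evalAt-∷-⊛ c cs n f) N ⟨
  shift n (evalAt (c ∷ cs) n ⊛ f) N ∎

-- Moves a factor t from the polynomial onto the series, where `Y-shift` can absorb it.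
evalAt-∷-⊛′ : ∀ c cs n f → evalAt (c ∷ cs) n ⊛ f ≗ (c · f) ⊕ (evalAt cs n ⊛ shift n f)
evalAt-∷-⊛′ c cs n f N = trans (evalAt-∷-⊛ c cs n f N) (cong (c * f N +_) (sym (evalAt-⊛-shift cs n f N)))

-- Monomials, and families of power series indexed by n.

mono-≢ : ∀ c {k N} → k ≢ N → mono c k N ≡ 0ℚ
mono-≢ c {k} {N} k≢N with k ℕ.≟ N
... | yes k≡N = contradiction k≡N k≢N
... | no  _   = refl

mono-linear : ∀ k N → Linear {A} (λ p x → mono (p x) k N)
mono-linear k N .≗-cong e i = cong (λ c → mono c k N) (e i)
mono-linear k N .homo-+ p p' i with k ℕ.≟ N
... | yes _ = refl
... | no  _ = refl
mono-linear k N .homo-* c p i with k ℕ.≟ N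
... | yes _ = refl
... | no  _ = sym (*-zeroʳ c)

mono-shift : ∀ c n k M → mono c (n ℕ.+ k) (n ℕ.+ M) ≡ mono c k M
mono-shift c n k M with n ℕ.+ k ℕ.≟ n ℕ.+ M | k ℕ.≟ M
... | yes _ | yes _ = refl
... | yes e | no ¬e = contradiction (ℕ.+-cancelˡ-≡ n k M e) ¬e
... | no ¬e | yes e = contradiction (cong (n ℕ.+_) e) ¬e
... | no _  | no _  = refl

mono-0 : ∀ c → mono c 0 ≗ c · 1s
mono-0 c zero    = sym (*-identityʳ c)
mono-0 c (suc N) = sym (*-zeroʳ c)

-- A family F(n), n ≥ 1, of power series is stored as (j , N) ↦ [q^N] F(j + 1).

Family : Set
Family = ℕ × ℕ → ℚ

slice : Family → ℕ → Series
slice F j N = F (j , N)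

-- The argument of p is v - 1.
lift : (ℕ → ℚ) → Family
lift p (j , N) = sumPos (λ v → mono (p (ℕ.pred v)) (suc j ℕ.* v)) N

lift-linear : Linear lift
lift-linear .≗-cong e (j , N) = sumBelow-cong N (λ i → cong (λ c → mono c (suc j ℕ.* suc i) N) (e i))
lift-linear .homo-+ p p' (j , N) = trans
  (sumBelow-cong N (λ i → mono-linear (suc j ℕ.* suc i) N .homo-+ p p' i))
  (sumBelow-+ N (λ i → mono (p i) (suc j ℕ.* suc i) N) (λ i → mono (p' i) (suc j ℕ.* suc i) N))
lift-linear .homo-* c p (j , N) = trans
  (sumBelow-cong N (λ i → mono-linear (suc j ℕ.* suc i) N .homo-* c p i))
  (sumBelow-* N c (λ i → mono (p i) (suc j ℕ.* suc i) N))

-- Splits off the term v = 1 and takes a factor t out of every term.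
lift-shift : ∀ j p → shift (suc j) ((p 0 · 1s) ⊕ slice (lift (p ∘ suc)) j) ≗ slice (lift p) j
lift-shift j p = shift-unfold n _ (slice (lift p) j) low high
  where
  n = suc j

  vanish : ∀ c i {N} → N ℕ.< suc i → mono c (n ℕ.* suc i) N ≡ 0ℚ
  vanish c i N<1+i = mono-≢ c (ℕ.>⇒≢ (ℕ.<-≤-trans N<1+i (ℕ.m≤n*m (suc i) n)))

  low : ∀ N → N ℕ.< n → slice (lift p) j N ≡ 0ℚ
  low N N<n = sumBelow-zero N _ (λ i _ →
    mono-≢ (p i) (ℕ.>⇒≢ (ℕ.<-≤-trans N<n (ℕ.m≤m*n n (suc i)))))

  high : ∀ M → slice (lift p) j (n ℕ.+ M) ≡ p 0 * 1s M + slice (lift (p ∘ suc)) j M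
  high M = begin
    sumBelow (suc (j ℕ.+ M)) h
      ≡⟨ sumBelow-head (j ℕ.+ M) h ⟩
    h 0 + sumBelow (j ℕ.+ M) (h ∘ suc)
      ≡⟨ cong₂ _+_
           (trans (cong (λ k → mono (p 0) k (n ℕ.+ M)) (ℕ.*-suc n 0))
             (trans (mono-shift (p 0) n (n ℕ.* 0) M)
               (trans (cong (λ k → mono (p 0) k M) (ℕ.*-zeroʳ n)) (mono-0 (p 0) M))))
           (sumBelow-cong (j ℕ.+ M) (λ i →
             trans (cong (λ k → mono (p (suc i)) k (n ℕ.+ M)) (ℕ.*-suc n (suc i)))
               (mono-shift (p (suc i)) n (n ℕ.* suc i) M))) ⟩
    p 0 * 1s M + sumBelow (j ℕ.+ M) h'
      ≡⟨ cong (λ m → p 0 * 1s M + sumBelow m h') (ℕ.+-comm j M) ⟩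
    p 0 * 1s M + sumBelow (M ℕ.+ j) h'
      -- The truncation of `sumPos` depends on the degree, so passing from degree n+M to M leaves
      -- `j` surplus terms. Their exponents exceed `M`.
      ≡⟨ cong (p 0 * 1s M +_) (sumBelow-split M j h') ⟩
    p 0 * 1s M + (sumBelow M h' + sumBelow j (λ i → h' (M ℕ.+ i)))
      ≡⟨ cong (λ z → p 0 * 1s M + (sumBelow M h' + z))
           (sumBelow-zero j _ (λ i _ → vanish (p (suc (M ℕ.+ i))) (M ℕ.+ i) (ℕ.s≤s (ℕ.m≤m+n M i)))) ⟩
    p 0 * 1s M + (sumBelow M h' + 0ℚ)
      ≡⟨ cong (p 0 * 1s M +_) (+-identityʳ (sumBelow M h')) ⟩
    p 0 * 1s M + sumBelow M h' ∎
    where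
    h h' : ℕ → ℚ
    h i  = mono (p i) (n ℕ.* suc i) (n ℕ.+ M)
    h' i = mono (p (suc i)) (n ℕ.* suc i) M

one : Family
one (j , N) = 1s N

-- With x = t/(1-t) and t = q^n, X k is x^k and Y k s is x^k (1+x)^s = t^k/(1-t)^{k+s}.

X : ℕ → Family
X zero    = one
X (suc k) = lift (bin k)

Y : ℕ → ℕ → Family
Y k zero    = X k
Y k (suc s) = λ x → Y k s x + Y (suc k) s x

-- Multiplication by t = x/(1+x) exchanges a factor 1+x for a factor x. At s = 0 this is
-- `lift-shift`, with Pascal's rule when k > 0.
Y-shift : ∀ j k s → shift (suc j) (slice (Y k (suc s)) j) ≗ slice (Y (suc k) s) j
Y-shift j zero    zero N = trans
  (shift-linear (suc j) .≗-cong (λ M → cong₂ _+_ (sym (*-identityˡ (1s M)))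
    (lift-linear .≗-cong (λ _ → refl) (j , M))) N)
  (lift-shift j (bin 0) N)
Y-shift j (suc k) zero N = trans
  (shift-linear (suc j) .≗-cong (λ M → trans (sym (lift-linear .homo-+ (bin k) (bin (suc k)) (j , M)))
    (sym (trans (cong (_+ slice (lift (bin (suc k) ∘ suc)) j M) (*-zeroˡ (1s M))) (+-identityˡ _)))) N)
  (lift-shift j (bin (suc k)) N)
Y-shift j k (suc s) N = trans
  (shift-linear (suc j) .homo-+ (slice (Y k (suc s)) j) (slice (Y (suc k) (suc s)) j) N)
  (cong₂ _+_ (Y-shift j k s N) (Y-shift j (suc k) s N))

-- At `suc s` both sides solve f = b + t·f, where b is the `s`-th power of 1/(1-t).
pow-geom : ∀ s j → pow s (geom (suc j)) ≗ slice (Y 0 s) j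
pow-geom zero    j N = refl
pow-geom (suc s) j = shift-fixpoint-unique j (pow s (geom (suc j)))
  (geom-⊛ j (pow s (geom (suc j))))
  (λ N → cong₂ _+_ (sym (pow-geom s j N)) (sym (Y-shift j 0 s N)))

-- The letters of the nested sums

zt : ℕ × Poly → Family
zt (s , Q) (j , N) = zterm s Q (suc j) N

bt : ℕ × ℕ → Family
bt (s , r) (j , N) = bterm s r (suc j) N

-- The series Σ v^p t^v over v ≥ 1, which is p! times the letter of the bracket [p+1].
tl : ℕ → Family
tl p = lift (power p)

evalAtF : Poly → Family → Family
evalAtF Q F (j , N) = (evalAt Q (suc j) ⊛ slice F j) N

zt-evalAtF : ∀ s Q → zt (s , Q) ≗ evalAtF Q (Y 0 s)
zt-evalAtF s Q (j , N) = ⊛-linearʳ (evalAt Q (suc j)) .≗-cong (pow-geom s j) N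

evalAtF-[] : ∀ F → evalAtF [] F ≗ λ _ → 0ℚ
evalAtF-[] F (j , N) = homo-0 (⊛-linearˡ (slice F j)) N

-- Each factor t uses up one factor 1+x; this is where the bound on the degree by the exponent
-- enters.
evalAtF-∷ : ∀ c cs k s → evalAtF (c ∷ cs) (Y k (suc s)) ≗ λ x → c * Y k (suc s) x + evalAtF cs (Y (suc k) s) x
evalAtF-∷ c cs k s (j , N) = trans (evalAt-∷-⊛′ c cs (suc j) (slice (Y k (suc s)) j) N)
  (cong (c * Y k (suc s) (j , N) +_) (⊛-linearʳ (evalAt cs (suc j)) .≗-cong (Y-shift j k s) N))

evalAtF-[-] : ∀ c F → evalAtF (c ∷ []) F ≗ λ x → c * F x
evalAtF-[-] c F (j , N) = trans (evalAt-∷-⊛′ c [] (suc j) (slice F j) N)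
  (trans (cong (c * F (j , N) +_) (homo-0 (⊛-linearˡ (shift (suc j) (slice F j))) N)) (+-identityʳ _))

evalAtF-0∷ : ∀ cs k s → evalAtF (0ℚ ∷ cs) (Y k (suc s)) ≗ evalAtF cs (Y (suc k) s)
evalAtF-0∷ cs k s x = trans (evalAtF-∷ 0ℚ cs k s x)
  (trans (cong (_+ evalAtF cs (Y (suc k) s) x) (*-zeroˡ (Y k (suc s) x))) (+-identityˡ _))

-- At least `d` factors 1+x remain once all factors t are absorbed: `d` is 0 for deg Q ≤ s and 1 for
-- deg Q ≤ s-1.
module _ {g : I → Family} (d : ℕ) where

  Y∈Span : ∀ k s → (∀ i → k ℕ.≤ i → Span g (Y i d)) → Span g (Y k (s ℕ.+ d))
  Y∈Span k zero    Y∈ = Y∈ k ℕ.≤-refl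
  Y∈Span k (suc s) Y∈ = add (Y∈Span k s Y∈) (Y∈Span (suc k) s (λ i k<i → Y∈ i (ℕ.<⇒≤ k<i)))

  evalAtF∈Span : ∀ cs k s → (∀ i → k ℕ.≤ i → Span g (Y i d)) →
                 length cs ℕ.+ d ℕ.≤ suc s → Span g (evalAtF cs (Y k s))
  evalAtF∈Span []       k s Y∈ _ = resp (sym ∘ evalAtF-[] (Y k s)) null
  -- A constant uses up no factor 1+x. It has its own case because `s` may be 0 here, which
  -- `evalAtF-∷` does not cover.
  evalAtF∈Span (c ∷ []) k s Y∈ (ℕ.s≤s d≤s) = resp (sym ∘ evalAtF-[-] c (Y k s))
    (mul c (subst (λ m → Span g (Y k m)) (ℕ.m∸n+n≡m d≤s) (Y∈Span k (s ∸ d) Y∈)))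
  evalAtF∈Span (c ∷ cs@(_ ∷ _)) k (suc s) Y∈ (ℕ.s≤s le) = resp (sym ∘ evalAtF-∷ c cs k s)
    (add (mul c (subst (λ m → Span g (Y k m)) (ℕ.m∸n+n≡m d≤s) (Y∈Span k (suc s ∸ d) Y∈)))
         (evalAtF∈Span cs (suc k) s (λ i k<i → Y∈ i (ℕ.<⇒≤ k<i)) le))
    where
    d≤s : d ℕ.≤ suc s
    d≤s = ℕ.m+n≤o⇒n≤o (length cs) le

  -- As Q(0) = 0, a factor t can be taken out first. It turns (1+x)^s into x(1+x)^(s-1), so only
  -- positive powers of x occur.
  zt∈Span : ∀ s Q → (∀ k → Span g (Y (suc k) d)) → 1 ℕ.≤ s → NoConst Q →
            length Q ℕ.+ d ℕ.≤ suc s → Span g (zt (s , Q))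
  zt∈Span s       []        Y∈ _ _    _           = resp (sym ∘ zt-evalAtF s []) (resp (sym ∘ evalAtF-[] (Y 0 s)) null)
  zt∈Span (suc s) (c ∷ cs)  Y∈ _ refl (ℕ.s≤s le) = resp (sym ∘ zt-evalAtF (suc s) (0ℚ ∷ cs))
    (resp (sym ∘ evalAtF-0∷ cs 0 s) (evalAtF∈Span cs 1 s (λ { (suc i) _ → Y∈ i }) le))

monomial : ℕ → Poly
monomial zero    = 1ℚ ∷ []
monomial (suc k) = 0ℚ ∷ monomial k

length-monomial : ∀ k → length (monomial k) ≡ suc k
length-monomial zero    = refl
length-monomial (suc k) = cong suc (length-monomial k)

evalAtF-monomial : ∀ k i d → evalAtF (monomial k) (Y i (k ℕ.+ d)) ≗ Y (k ℕ.+ i) d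
evalAtF-monomial zero    i d x = trans (evalAtF-[-] 1ℚ (Y i d) x) (*-identityˡ (Y i d x))
evalAtF-monomial (suc k) i d x = trans (evalAtF-0∷ (monomial k) i (k ℕ.+ d) x)
  (trans (evalAtF-monomial k (suc i) d x) (cong (λ m → Y m d x) (ℕ.+-suc k i)))

-- Since t^k/(1-t)^(k+d) = x^k (1+x)^d, each element of the binomial basis is itself a letter.
zt-monomial : ∀ k d → zt (k ℕ.+ d , monomial k) ≗ Y k d
zt-monomial k d x = trans (zt-evalAtF (k ℕ.+ d) (monomial k) x)
  (trans (evalAtF-monomial k 0 d x) (cong (λ m → Y m d x) (ℕ.+-identityʳ k)))

ztGood : ∃ GoodEntry → Family
ztGood (e , _) = zt e

ztCirc : ∃ CircEntry → Family
ztCirc (e , _) = zt e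

ztCirc1 : ∃ Circ1Entry → Family
ztCirc1 (e , _) = zt e

-- Here `nothing` is the letter 1, the constant term in x that appears when Q(0) is nonzero.
tl? : Maybe ℕ → Family
tl? nothing  = one
tl? (just p) = tl p

X∈tl : ∀ k → Span tl (X (suc k))
X∈tl k = map-Span lift-linear gen (bin∈power k)

lift-bin₁ : ∀ k → lift (bin₁ k) ≗ Y (suc k) 1
lift-bin₁ k = lift-linear .homo-+ (bin k) (bin (suc k))

ztCirc∈tl : ∀ e → CircEntry e → Span tl (zt e)
ztCirc∈tl (s , Q) (1≤s , nc , le) =
  zt∈Span 0 s Q X∈tl 1≤s nc (subst (ℕ._≤ suc s) (sym (ℕ.+-identityʳ (length Q))) le)

ztCirc1∈tl∘suc : ∀ e → Circ1Entry e → Span (tl ∘ suc) (zt e)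
ztCirc1∈tl∘suc (s , Q) (1≤s , nc , le) =
  zt∈Span 1 s Q (λ k → resp (lift-bin₁ k) (map-Span lift-linear gen (bin₁∈power∘suc k))) 1≤s nc
    (subst (ℕ._≤ suc s) (ℕ.+-comm 1 (length Q)) (ℕ.s≤s le))

ztGood∈tl? : ∀ e → GoodEntry e → Span tl? (zt e)
ztGood∈tl? (s , Q) (1≤s , le) = resp (sym ∘ zt-evalAtF s Q)
  (evalAtF∈Span 0 Q 0 s
    (λ { zero _ → gen nothing ; (suc k) _ → Span-trans (gen ∘ just) (X∈tl k) })
    (subst (ℕ._≤ suc s) (sym (ℕ.+-identityʳ (length Q))) le))

tl∈ztCirc : ∀ p → Span ztCirc (tl p)
tl∈ztCirc p = map-Span lift-linear
  (λ k → resp (zt-monomial (suc k) 0) (gen ((suc k ℕ.+ 0 , monomial (suc k)) , ℕ.s≤s ℕ.z≤n , refl ,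
    ℕ.≤-reflexive (trans (length-monomial (suc k)) (cong (suc ∘ suc) (sym (ℕ.+-identityʳ k)))))))
  (power∈bin p)

tl-suc∈ztCirc1 : ∀ p → Span ztCirc1 (tl (suc p))
tl-suc∈ztCirc1 p = map-Span lift-linear
  (λ k → resp (λ x → trans (zt-monomial (suc k) 1 x) (sym (lift-bin₁ k x))) (gen ((suc k ℕ.+ 1 , monomial (suc k)) , ℕ.s≤s ℕ.z≤n , refl ,
    ℕ.≤-reflexive (trans (length-monomial (suc k)) (cong suc (ℕ.+-comm 1 k))))))
  (power∘suc∈bin₁ p)

-- 1 = (1 - t)/(1 - t)
one∈ztGood : Span ztGood one
one∈ztGood = resp
  (λ x → begin
    zt (1 , 1ℚ ∷ - 1ℚ ∷ []) x                              ≡⟨ zt-evalAtF 1 (1ℚ ∷ - 1ℚ ∷ []) x ⟩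
    evalAtF (1ℚ ∷ - 1ℚ ∷ []) (Y 0 1) x                      ≡⟨ evalAtF-∷ 1ℚ (- 1ℚ ∷ []) 0 0 x ⟩
    1ℚ * (X 0 x + X 1 x) + evalAtF (- 1ℚ ∷ []) (X 1) x      ≡⟨ cong (1ℚ * (X 0 x + X 1 x) +_) (evalAtF-[-] (- 1ℚ) (X 1) x) ⟩
    1ℚ * (X 0 x + X 1 x) + (- 1ℚ) * X 1 x
      ≡⟨ solve 2 (λ a b → con 1ℚ :* (a :+ b) :+ con (- 1ℚ) :* b := a) refl (X 0 x) (X 1 x) ⟩
    one x                                                  ∎)
  (gen ((1 , 1ℚ ∷ - 1ℚ ∷ []) , ℕ.s≤s ℕ.z≤n , ℕ.≤-refl))

-- Scaling by functions of n, and the letters of bi-brackets.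

scale : (ℕ → ℚ) → Family → Family
scale c F (i , N) = c i * F (i , N)

scale-linearˡ : ∀ F → Linear (λ c → scale c F)
scale-linearˡ F .≗-cong e (i , N)       = cong (_* F (i , N)) (e i)
scale-linearˡ F .homo-+ c c' (i , N)    = *-distribʳ-+ (F (i , N)) (c i) (c' i)
scale-linearˡ F .homo-* d c (i , N)     = *-assoc d (c i) (F (i , N))

scale-linearʳ : ∀ c → Linear (scale c)
scale-linearʳ c = scale-linear (λ (i , N) → c i)

weight : Family → Family
weight = scale (natQ ∘ suc)

-- Isolates the factor n^r, which depends on n alone and can be passed to the inner sum by
-- `S-scale`.
bt-tl : ∀ p r → bt (suc p , r) ≗ λ x → (invFact r * invFact p) * scale (power r) (tl p) x
bt-tl p r (j , N) = begin
  bt (suc p , r) (j , N)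
    ≡⟨ lift-linear .homo-* (powFact (suc j) r) (λ i → powFact (suc i) p) (j , N) ⟩
  powFact (suc j) r * lift (λ i → powFact (suc i) p) (j , N)
    ≡⟨ cong₂ _*_ (powFact-power j r)
        (trans (lift-linear .≗-cong (λ i → powFact-power i p) (j , N)) (lift-linear .homo-* (invFact p) (power p) (j , N))) ⟩
  (invFact r * power r j) * (invFact p * tl p (j , N))
    ≡⟨ solve 4 (λ a b c d → (a :* b) :* (c :* d) := (a :* c) :* (b :* d)) refl
        (invFact r) (power r j) (invFact p) (tl p (j , N)) ⟩
  (invFact r * invFact p) * (power r j * tl p (j , N)) ∎

invFact-invertible : ∀ r p → (natQ (r !) * natQ (p !)) * (invFact r * invFact p) ≡ 1ℚ
invFact-invertible r p = begin
  (natQ (r !) * natQ (p !)) * (invFact r * invFact p)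
    ≡⟨ solve 4 (λ a b c d → (a :* b) :* (c :* d) := (c :* a) :* (d :* b)) refl
        (natQ (r !)) (natQ (p !)) (invFact r) (invFact p) ⟩
  (invFact r * natQ (r !)) * (invFact p * natQ (p !))
    ≡⟨ cong₂ _*_ (invFact*fact r) (invFact*fact p) ⟩
  1ℚ * 1ℚ ≡⟨ *-identityˡ 1ℚ ⟩
  1ℚ ∎

brLetter : ∀ k → (∃ λ s → k ℕ.≤ s) → Family
brLetter k (s , _) = bt (s , 0)

scale-1 : ∀ F → scale (power 0) F ≗ F
scale-1 F x = *-identityˡ (F x)

tl∈brLetter : ∀ k p → k ℕ.≤ suc p → Span (brLetter k) (tl p)
tl∈brLetter k p le = resp (scale-1 (tl p))
  (cancel (invFact 0 * invFact p) (natQ (0 !) * natQ (p !)) (invFact-invertible 0 p) (resp (bt-tl p 0) (gen (suc p , le))))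

bt∈Span : ∀ {g : I → Family} p → Span g (tl p) → Span g (bt (suc p , 0))
bt∈Span p s = resp (λ x → sym (bt-tl p 0 x)) (mul (invFact 0 * invFact p) (resp (λ x → sym (scale-1 (tl p) x)) s))

-- Nested sums

-- The sum of a(n')F(n') over 0 < n' < n, where n = i+1. Keeping the outer bound as an index makes
-- the result a family again, to which a further letter can be applied.
S : Family → Family → Family
S a F (i , N) = sumBelow i (λ j → (slice a j ⊛ slice F j) N)

S-linearˡ : ∀ F → Linear (λ a → S a F)
S-linearˡ F .≗-cong e (i , N) = sumBelow-cong i (λ j → ⊛-linearˡ (slice F j) .≗-cong (λ M → e (j , M)) N)
S-linearˡ F .homo-+ a b (i , N) = trans
  (sumBelow-cong i (λ j → ⊛-linearˡ (slice F j) .homo-+ (slice a j) (slice b j) N)) (sumBelow-+ i _ _)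
S-linearˡ F .homo-* c a (i , N) = trans
  (sumBelow-cong i (λ j → ⊛-linearˡ (slice F j) .homo-* c (slice a j) N)) (sumBelow-* i c _)

S-linearʳ : ∀ a → Linear (S a)
S-linearʳ a .≗-cong e (i , N) = sumBelow-cong i (λ j → ⊛-linearʳ (slice a j) .≗-cong (λ M → e (j , M)) N)
S-linearʳ a .homo-+ F G (i , N) = trans
  (sumBelow-cong i (λ j → ⊛-linearʳ (slice a j) .homo-+ (slice F j) (slice G j) N)) (sumBelow-+ i _ _)
S-linearʳ a .homo-* c F (i , N) = trans
  (sumBelow-cong i (λ j → ⊛-linearʳ (slice a j) .homo-* c (slice F j) N)) (sumBelow-* i c _)

S-Span : ∀ {g : I → Family} {h : K → Family} {u : A → Family} {a F} →
         Span g a → Span h F → (∀ i k → Span u (S (g i) (h k))) → Span u (S a F)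
S-Span {g = g} {F = F} s t σ = map-Span (S-linearˡ F) (λ i → map-Span (S-linearʳ (g i)) (σ i) t) s

-- A scalar depending only on the summation index passes through the product. Applied to n^r, it
-- turns a lower entry of a bi-bracket into a weight on the inner sum.
S-scale : ∀ c a F → S (scale c a) F ≗ S a (scale c F)
S-scale c a F (i , N) = sumBelow-cong i (λ j → trans
  (⊛-linearˡ (slice F j) .homo-* (c j) (slice a j) N)
  (sym (⊛-linearʳ (slice a j) .homo-* (c j) (slice F j) N)))

S-one : ∀ F i N → S one F (i , N) ≡ sumBelow i (λ j → F (j , N))
S-one F i N = sumBelow-cong i (λ j → ⊛-identityˡ (slice F j) N)

S-bt : ∀ p r F → S (bt (suc p , r)) F ≗ λ x → (invFact r * invFact p) * S (tl p) (scale (power r) F) x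
S-bt p r F x = begin
  S (bt (suc p , r)) F x                                ≡⟨ S-linearˡ F .≗-cong (bt-tl p r) x ⟩
  S (λ y → K' * scale (power r) (tl p) y) F x           ≡⟨ S-linearˡ F .homo-* K' (scale (power r) (tl p)) x ⟩
  K' * S (scale (power r) (tl p)) F x                   ≡⟨ cong (K' *_) (S-scale (power r) (tl p) F x) ⟩
  K' * S (tl p) (scale (power r) F) x                   ∎
  where K' = invFact r * invFact p

word : (I → Family) → List I → Family
word ℓ []      = one
word ℓ (i ∷ w) = S (ℓ i) (word ℓ w)

-- Nested sums are linear in each letter, so letters can be expanded one at a time.
word-Span : ∀ {ℓ : I → Family} {ℓ' : K → Family} {E : I → Set} {E' : K → Set} →
            (∀ i → E i → Span (λ (x : ∃ E') → ℓ' (proj₁ x)) (ℓ i)) →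
            ∀ w → All E w → Span (λ (v : ∃ (All E')) → word ℓ' (proj₁ v)) (word ℓ w)
word-Span σ []      []       = gen ([] , [])
word-Span σ (i ∷ w) (e ∷ es) = S-Span (σ i e) (word-Span σ w es)
  (λ (k , e') (v , es') → gen (k ∷ v , e' ∷ es'))

word-map : ∀ (ℓ : K → Family) (f : I → K) w → word ℓ (map f w) ≗ word (ℓ ∘ f) w
word-map ℓ f []      x = refl
word-map ℓ f (i ∷ w) x = S-linearʳ (ℓ (f i)) .≗-cong (word-map ℓ f w) x

-- The outer sum of a generator runs over n ≤ N in degree N, so it is the value at m = N + 1 of
-- the corresponding truncated sum over n < m.
diag : Family → Series
diag F N = F (N , N)

diag-linear : Linear diag
diag-linear .≗-cong e N     = e (N , N)
diag-linear .homo-+ F G N   = refl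
diag-linear .homo-* c F N   = refl

-- With bound i+1, `sumBetween` has the terms n = 1,...,i, which are stored at 0,...,i-1.
zetaBelow-word : ∀ L i N → zetaBelow L (suc i) N ≡ word zt L (i , N)
zetaBelow-word []      i N = refl
zetaBelow-word (e ∷ L) i N = sumBelow-cong i (λ j →
  ⊛-linearʳ (slice (zt e) j) .≗-cong (zetaBelow-word L j) N)

zetaq-word : ∀ L → zetaq L ≗ diag (word zt L)
zetaq-word []      N = refl
zetaq-word (e ∷ L) N = zetaBelow-word (e ∷ L) N N

bracketBelow-word : ∀ L i N → bracketBelow L (suc i) N ≡ word bt L (i , N)
bracketBelow-word []      i N = refl
bracketBelow-word (e ∷ L) i N = sumBelow-cong i (λ j →
  ⊛-linearʳ (slice (bt e) j) .≗-cong (bracketBelow-word L j) N)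

bibracket-word : ∀ L → bibracket L ≗ diag (word bt L)
bibracket-word []      N = refl
bibracket-word (e ∷ L) N = bracketBelow-word (e ∷ L) N N

bracket-word : ∀ w → bracket w ≗ diag (word (λ s → bt (s , 0)) w)
bracket-word w N = trans (bibracket-word (map (λ s → s , 0) w) N) (word-map bt (λ s → s , 0) w (N , N))

diag-Span : ∀ {g : I → Family} {h : I → Series} {F} → (∀ i → h i ≗ diag (g i)) →
            Span g F → Span h (diag F)
diag-Span e = map-Span diag-linear (λ i → resp (e i) (gen i))

zeta-bracket-sameSpan : ∀ {E : ℕ × Poly → Set} k →
  (∀ e → E e → Span (brLetter k) (zt e)) →
  (∀ s → k ℕ.≤ s → Span (λ (x : ∃ E) → zt (proj₁ x)) (bt (s , 0))) →
  SameSpan (λ (L : ∃ (All E)) → zetaq (proj₁ L)) (brGen k)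
zeta-bracket-sameSpan k z⊆b b⊆z = sameSpan
  (λ (L , es) → resp (sym ∘ zetaq-word L) (diag-Span (bracket-word ∘ proj₁) (word-Span z⊆b L es)))
  (λ (w , es) → resp (sym ∘ bracket-word w) (diag-Span (zetaq-word ∘ proj₁) (word-Span b⊆z w es)))

-- Summation by parts

-- For l < i the difference (i+1) - (l+1) counts the j with l < j < i, and one more. These account
-- for the double sum and the extra single sum.
sum-weight : ∀ f i → natQ (suc i) * sumBelow i f ≡
  (sumBelow i (λ j → sumBelow j f) + sumBelow i f) + sumBelow i (λ j → natQ (suc j) * f j)
sum-weight f zero    = refl
sum-weight f (suc i) = begin
  natQ (suc (suc i)) * (G + f i)
    ≡⟨ cong (_* (G + f i)) (natQ-suc (suc i)) ⟩
  (1ℚ + n) * (G + f i)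
    ≡⟨ solve 3 (λ n g a → (con 1ℚ :+ n) :* (g :+ a) := n :* g :+ (g :+ a :+ n :* a)) refl n G (f i) ⟩
  n * G + (G + f i + n * f i)
    ≡⟨ cong (_+ (G + f i + n * f i)) (sum-weight f i) ⟩
  ((GG + G) + H) + (G + f i + n * f i)
    ≡⟨ solve 5 (λ gg g h a b → ((gg :+ g) :+ h) :+ (g :+ a :+ b) := ((gg :+ g) :+ (g :+ a)) :+ (h :+ b))
        refl GG G H (f i) (n * f i) ⟩
  ((GG + G) + (G + f i)) + (H + n * f i) ∎
  where
  n = natQ (suc i)
  G = sumBelow i f
  GG = sumBelow i (λ j → sumBelow j f)
  H = sumBelow i (λ j → natQ (suc j) * f j)

-- Discrete product rule: the two summands on the left add up to the increment, from j to j+1, of (j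
-- choose k+1) times the partial sum of `f`, and the increments telescope.
sum-bin : ∀ k f i → sumBelow i (λ j → bin₁ k j * f j) + sumBelow i (λ j → bin k j * sumBelow j f)
                    ≡ bin (suc k) i * sumBelow i f
sum-bin k f zero    = refl
sum-bin k f (suc i) = begin
  (A' + (b + b₊) * f i) + (B' + b * G)
    ≡⟨ solve 6 (λ x y b b₊ a g → (x :+ (b :+ b₊) :* a) :+ (y :+ b :* g) := (x :+ y) :+ (b :* g :+ (b :+ b₊) :* a))
        refl A' B' b b₊ (f i) G ⟩
  (A' + B') + (b * G + (b + b₊) * f i)
    ≡⟨ cong (_+ (b * G + (b + b₊) * f i)) (sum-bin k f i) ⟩
  b₊ * G + (b * G + (b + b₊) * f i)
    ≡⟨ solve 4 (λ b b₊ a g → b₊ :* g :+ (b :* g :+ (b :+ b₊) :* a) := (b :+ b₊) :* (g :+ a)) refl b b₊ (f i) G ⟩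
  (b + b₊) * (G + f i) ∎
  where
  b = bin k i
  b₊ = bin (suc k) i
  G = sumBelow i f
  A' = sumBelow i (λ j → bin₁ k j * f j)
  B' = sumBelow i (λ j → bin k j * sumBelow j f)

weight-one : weight one ≗ λ x → one x + S one one x
weight-one (i , N) = trans (lemma i) (cong (1s N +_) (sym (S-one one i N)))
  where
  lemma : ∀ i → natQ (suc i) * 1s N ≡ 1s N + sumBelow i (λ _ → 1s N)
  lemma zero    = trans (*-identityˡ (1s N)) (sym (+-identityʳ (1s N)))
  lemma (suc i) = begin
    natQ (suc (suc i)) * 1s N                       ≡⟨ cong (_* 1s N) (natQ-suc (suc i)) ⟩
    (1ℚ + natQ (suc i)) * 1s N                      ≡⟨ solve 2 (λ n a → (con 1ℚ :+ n) :* a := n :* a :+ a) refl (natQ (suc i)) (1s N) ⟩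
    natQ (suc i) * 1s N + 1s N                      ≡⟨ cong (_+ 1s N) (lemma i) ⟩
    (1s N + sumBelow i (λ _ → 1s N)) + 1s N         ≡⟨ +-assoc (1s N) (sumBelow i (λ _ → 1s N)) (1s N) ⟩
    1s N + (sumBelow i (λ _ → 1s N) + 1s N)         ∎

-- By `sum-weight` the factor n moves to the inner sum, at the cost of the sum itself and of a sum
-- with the letter 1 in front.
weight-S : ∀ a F → weight (S a F) ≗ λ x → (S one (S a F) x + S a F x) + S a (weight F) x
weight-S a F (i , N) = trans (sum-weight (λ j → (slice a j ⊛ slice F j) N) i)
  (cong₂ (λ y z → (y + S a F (i , N)) + z)
    (sym (S-one (S a F) i N))
    (sumBelow-cong i (λ j → sym (⊛-linearʳ (slice a j) .homo-* (natQ (suc j)) (slice F j) N))))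

-- The hockey-stick identity.
bin-one : ∀ k → S one (scale (bin k) one) ≗ scale (bin (suc k)) one
bin-one k (i , N) = trans (S-one (scale (bin k) one) i N) (lemma i)
  where
  lemma : ∀ i → sumBelow i (λ j → bin k j * 1s N) ≡ bin (suc k) i * 1s N
  lemma zero    = sym (*-zeroˡ (1s N))
  lemma (suc i) = trans (cong (_+ bin k i * 1s N) (lemma i))
    (solve 3 (λ b b₊ a → b₊ :* a :+ b :* a := (b :+ b₊) :* a) refl (bin k i) (bin (suc k) i) (1s N))

-- Serves to remove a letter 1 in front of a weighted nested sum, at the price of a weight of higher
-- degree.
bin-S : ∀ k a F → (λ x → S a (scale (bin₁ k) F) x + S one (scale (bin k) (S a F)) x) ≗ scale (bin (suc k)) (S a F)
bin-S k a F (i , N) = trans (cong₂ _+_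
  (sumBelow-cong i (λ j → ⊛-linearʳ (slice a j) .homo-* (bin₁ k j) (slice F j) N))
  (S-one (scale (bin k) (S a F)) i N))
  (sum-bin k (λ j → (slice a j ⊛ slice F j) N) i)

-- Polynomially weighted bi-brackets

zw : ∃ (All GoodEntry) → Family
zw (L , _) = word zt L

zwFirst : ZIdx → Family
zwFirst (L , _) = word zt L

bw : BiIdx → Family
bw (L , _) = word bt L

-- Summation by the letter 1 produces powers of the outer bound n. Admitting them as weights makes
-- the span stable under it, and the next letter `tl p` absorbs them.
pbw : ℕ × BiIdx → Family
pbw (r , L) = scale (power r) (bw L)

power-closed : ∀ {g : I → Family} → (∀ {F} → Span g F → Span g (weight F)) →
               ∀ r {F} → Span g F → Span g (scale (power r) F)
power-closed closed zero    {F} s = resp (sym ∘ scale-1 F) s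
power-closed closed (suc r) {F} s = resp
  (λ (i , N) → sym (*-assoc (natQ (suc i)) (power r i) (F (i , N)))) (closed (power-closed closed r s))

zw-S : ∀ {a F} → Span ztGood a → Span zw F → Span zw (S a F)
zw-S s t = S-Span s t (λ (e , good) (L , goods) → gen (e ∷ L , good ∷ goods))

-- Induction on the depth by `weight-S`; the letter 1 that this creates is allowed by `one∈ztGood`.
zw-weight : ∀ {F} → Span zw F → Span zw (weight F)
zw-weight = map-Span (scale-linearʳ (natQ ∘ suc)) (λ (L , goods) → weight-word L goods)
  where
  weight-word : ∀ L → All GoodEntry L → Span zw (weight (word zt L))
  weight-word []      []             = resp (sym ∘ weight-one)
    (add (gen ([] , [])) (zw-S one∈ztGood (gen ([] , []))))
  weight-word (e ∷ L) (good ∷ goods) = resp (sym ∘ weight-S (zt e) (word zt L))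
    (add (add (zw-S one∈ztGood word∈) word∈) (zw-S (gen (e , good)) (weight-word L goods)))
    where
    word∈ : Span zw (word zt (e ∷ L))
    word∈ = gen (e ∷ L , good ∷ goods)

tl∈ztGood : ∀ p → Span ztGood (tl p)
tl∈ztGood p = Span-trans (λ (e , 1≤s , _ , deg) → gen (e , 1≤s , deg)) (tl∈ztCirc p)

bw∈zw : ∀ L → All (λ p → 1 ℕ.≤ proj₁ p) L → Span zw (word bt L)
bw∈zw []                []             = gen ([] , [])
bw∈zw ((suc p , r) ∷ L) (_ ∷ positive) = resp (sym ∘ S-bt p r (word bt L))
  (mul (invFact r * invFact p) (zw-S (tl∈ztGood p) (power-closed zw-weight r (bw∈zw L positive))))

-- Only the outermost letter must satisfy Q(0) = 0, and `tl p` is a combination of such letters. The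
-- inner sums may use the letter 1 freely.
bw∈zwFirst : ∀ i → Span zwFirst (bw i)
bw∈zwFirst ([] , [])                             = gen ([] , _ , [])
bw∈zwFirst ((suc p , r) ∷ L , _ ∷ positive)      = resp (sym ∘ S-bt p r (word bt L))
  (mul (invFact r * invFact p) (S-Span (tl∈ztCirc p) (power-closed zw-weight r (bw∈zw L positive))
    (λ (e , 1≤s , nc , deg) (L , goods) → gen (e ∷ L , nc , (1≤s , deg) ∷ goods))))

-- The weight n^r becomes the lower entry of the new outermost letter; r! p! clears the
-- denominators.
tl-pbw∈bw : ∀ p i → Span bw (S (tl p) (pbw i))
tl-pbw∈bw p (r , L , positive) = cancel (invFact r * invFact p) (natQ (r !) * natQ (p !)) (invFact-invertible r p)
  (resp (S-bt p r (word bt L)) (gen ((suc p , r) ∷ L , ℕ.s≤s ℕ.z≤n ∷ positive)))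

bw⊆pbw : ∀ i → Span pbw (bw i)
bw⊆pbw i = resp (scale-1 (bw i)) (gen (0 , i))

pbw-weight : ∀ {F} → Span pbw F → Span pbw (weight F)
pbw-weight = map-Span (scale-linearʳ (natQ ∘ suc)) (λ (r , L) →
  resp (λ (i , N) → *-assoc (natQ (suc i)) (power r i) (bw L (i , N))) (gen (suc r , L)))

pbw-bin : ∀ k {F} → Span pbw F → Span pbw (scale (bin k) F)
pbw-bin k {F} s = map-Span (scale-linearˡ F) (λ r → power-closed pbw-weight r s) (bin∈power k)

pbw-S-tl : ∀ p {F} → Span pbw F → Span pbw (S (tl p) F)
pbw-S-tl p = map-Span (S-linearʳ (tl p)) (λ i → Span-trans bw⊆pbw (tl-pbw∈bw p i))

-- Powers are first rewritten in binomial coefficients, which have explicit partial sums.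
pbw-S-one : ∀ {F} → Span pbw F → Span pbw (S one F)
pbw-S-one = map-Span (S-linearʳ one) (λ (r , i) →
  map-Span (S-linearʳ one ∘-linear scale-linearˡ (bw i)) (λ k → S-one-bin k i) (power∈bin r))
  where
  S-one-bin : ∀ k i → Span pbw (S one (scale (bin k) (bw i)))
  S-one-bin k ([] , []) = resp (sym ∘ bin-one k) (pbw-bin (suc k) (bw⊆pbw ([] , [])))
  -- This is `bin-S` solved for the term with the letter 1. The right side is a weighted bi-bracket,
  -- and in the other term `tl p` absorbs all weights.
  S-one-bin k i@((suc p , r) ∷ L , _ ∷ positive) = subtract
    (resp (sym ∘ bin-S k (bt (suc p , r)) W) (pbw-bin (suc k) (bw⊆pbw i)))
    (resp (sym ∘ S-bt p r (scale (bin₁ k) W)) (mul (invFact r * invFact p) (pbw-S-tl p (power-closed pbw-weight r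
      (resp (λ x → sym (scale-linearˡ W .homo-+ (bin k) (bin (suc k)) x)) (add (pbw-bin k W∈) (pbw-bin (suc k) W∈)))))))
    where
    W : Family
    W = word bt L
    W∈ : Span pbw W
    W∈ = bw⊆pbw (L , positive)

zw∈pbw : ∀ L → All GoodEntry L → Span pbw (word zt L)
zw∈pbw []      []             = bw⊆pbw ([] , [])
zw∈pbw (e ∷ L) (good ∷ goods) = map-Span (S-linearˡ (word zt L))
  (λ { nothing → pbw-S-one (zw∈pbw L goods) ; (just p) → pbw-S-tl p (zw∈pbw L goods) }) (ztGood∈tl? e good)

-- The first letter has no constant term, so it is a combination of the `tl p` alone, and each of
-- these absorbs the weight of the inner part.
zwFirst∈bw : ∀ i → Span bw (zwFirst i)
zwFirst∈bw ([] , _ , [])                        = gen ([] , [])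
zwFirst∈bw (e ∷ L , nc , (1≤s , deg) ∷ goods)   =
  S-Span (ztCirc∈tl e (1≤s , nc , deg)) (zw∈pbw L goods) tl-pbw∈bw

mainTheorem1 : SameSpan zetaGen biGen × SameSpan zetaCircGen (brGen 1) × SameSpan zetaCirc1Gen (brGen 2)
mainTheorem1
  = sameSpan
      (λ i → resp (sym ∘ zetaq-word (proj₁ i)) (diag-Span (bibracket-word ∘ proj₁) (zwFirst∈bw i)))
      (λ i → resp (sym ∘ bibracket-word (proj₁ i)) (diag-Span (zetaq-word ∘ proj₁) (bw∈zwFirst i)))
  , zeta-bracket-sameSpan 1
      (λ e circ → Span-trans (λ p → tl∈brLetter 1 p (ℕ.s≤s ℕ.z≤n)) (ztCirc∈tl e circ))
      (λ { (suc p) _ → bt∈Span p (tl∈ztCirc p) })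
  , zeta-bracket-sameSpan 2
      -- The power v^(p+1) belongs to the entry s = p+2: exponents at least 1 match entries at least
      -- 2.
      (λ e circ → Span-trans (λ p → tl∈brLetter 2 (suc p) (ℕ.s≤s (ℕ.s≤s ℕ.z≤n))) (ztCirc1∈tl∘suc e circ))
      (λ { (suc (suc p)) _ → bt∈Span (suc p) (tl-suc∈ztCirc1 p) ; (suc zero) (ℕ.s≤s ()) })
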